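{- Consider the three-pile Amalgamation Nim with Restriction, with positions $(x,y,z)\in\mathbb{Z}_{\ge 0}^3$. The set $P$ is exactly the set of $\mathcal{P}$-positions of this game; that is, for all $(x,y,z)\in\mathbb{Z}_{\ge 0}^3$, the position $(x,y,z)$ is a $\mathcal{P}$-position if and only if $(x,y,z)\in P$.
   Context: $\mathbb{Z}_{\ge 0}$ denotes the non-negative integers and $\oplus$ denotes nim-sum (bitwise exclusive or of binary expansions). The game (Amalgamation Nim with Restriction, three piles): a position is $(x,y,z)\in\mathbb{Z}_{\ge 0}^3$, the numbers of stones in the first, second and third pile. Two players alternate; the player who makes the last legal move wins. In a move, a player does one of the following. (1) (Removal) Choose a pile and remove any positive number of stones from it: $(x,y,z)\to(u,y,z)$ with $0\le u<x$, or $(x,v,z)$ with $0\le v<y$, or $(x,y,w)$ with $0\le w<z$. (2) (Amalgamation) Choose two piles each containing at least 2 stones and replace them by a single pile containing their total: $(x,y,z)\to(x+y,0,z)$ or $(0,x+y,z)$ if $x,y\ge 2$; $(x,y,z)\to(x,y+z,0)$ or $(x,0,y+z)$ if $y,z\ge 2$; $(x,y,z)\to(x+z,y,0)$ or $(0,y,x+z)$ if $x,z\ge 2$. A $\mathcal{P}$-position is a position from which the previous player (the one who has just moved) has a winning strategy; otherwise it is an $\mathcal{N}$-position. Sets of triples (all $x,y,z\in\mathbb{Z}_{\ge 0}$): $P_{0,1}=\{(x,y,z): x+y=z,\ x,y\le z,\ x\oplus y\oplus z=0,\ \min(x,y)<2\}$. $P_{0,2}=\{(x,y,z): x+y>z+2,\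 x,y\le z,\ x\oplus y\oplus z=0\}$. $N_{0,1}=\{(x,y,z): x+y=z,\ x,y\le z,\ x\oplus y\oplus z=0,\ x,y\ge 2\}$. $N_{0,2}=\{(x,y,z): x+y=z+2,\ x,y\le z,\ x\oplus y\oplus z=0\}$. For $k\in\{1,2\}$: $P_{1,k}=\{(x,y,z+1): x+y \text{ even},\ (x,y,z)\in N_{0,k}\}\cup\{(x,y,z-1): x+y\text{ odd},\ (x,y,z)\in N_{0,k}\}$. For $k\in\{0,1\}$: $P_k$ is the set of all $(x,y,z)$ such that at least one of $(x,y,z)$, $(x,z,y)$, $(y,z,x)$ belongs to $P_{k,1}\cup P_{k,2}$. $P=P_0\cup P_1$. -}

module Defs where

open import Data.Digit using (Bit; 0b; 1b; Expansion; toDigits; fromDigits)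
open import Data.Fin.Base using (zero; suc)
open import Data.List.Base using (alignWith)
open import Data.Nat.Base using (ℕ; suc; _+_; _≤_; _<_; _>_; _⊓_)
open import Data.Nat.Divisibility using (_∣_; _∤_)
open import Data.Product.Base using (∃; _×_; _,_; proj₁)
open import Data.Sum.Base using (_⊎_)
open import Data.These.Base using (fold)
open import Function.Base using (id)
open import Level using (0ℓ)
open import Relation.Binary.Core using (Rel)
open import Relation.Binary.PropositionalEquality using (_≡_; refl)
open import Relation.Unary using (Pred; _∈_; _∪_)

_xor_ : Bit → Bit → Bit
zero     xor b        = b
suc zero xor zero     = 1b
suc zero xor suc zero = 0b

-- Expansions start with the least significant bit, so bits of equal weight
-- are aligned and the shorter expansion is padded with zeros at the top.
_xorₑ_ : Expansion 2 → Expansion 2 → Expansion 2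
_xorₑ_ = alignWith (fold id id _xor_)

infixl 6 _⊕_

_⊕_ : ℕ → ℕ → ℕ
m ⊕ n = fromDigits (proj₁ (toDigits 2 m) xorₑ proj₁ (toDigits 2 n))

_ : 6 ⊕ 3 ≡ 5
_ = refl

_ : 1 ⊕ 12 ≡ 13
_ = refl

Position : Set
Position = ℕ × ℕ × ℕ

infix 4 _⟶_

data _⟶_ : Rel Position 0ℓ where
  remove₁  : ∀ {x y z u} → u < x → (x , y , z) ⟶ (u , y , z)
  remove₂  : ∀ {x y z v} → v < y → (x , y , z) ⟶ (x , v , z)
  remove₃  : ∀ {x y z w} → w < z → (x , y , z) ⟶ (x , y , w)
  merge₁₂ˡ : ∀ {x y z} → 2 ≤ x → 2 ≤ y → (x , y , z) ⟶ (x + y , 0 , z)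
  merge₁₂ʳ : ∀ {x y z} → 2 ≤ x → 2 ≤ y → (x , y , z) ⟶ (0 , x + y , z)
  merge₂₃ˡ : ∀ {x y z} → 2 ≤ y → 2 ≤ z → (x , y , z) ⟶ (x , y + z , 0)
  merge₂₃ʳ : ∀ {x y z} → 2 ≤ y → 2 ≤ z → (x , y , z) ⟶ (x , 0 , y + z)
  merge₁₃ˡ : ∀ {x y z} → 2 ≤ x → 2 ≤ z → (x , y , z) ⟶ (x + z , y , 0)
  merge₁₃ʳ : ∀ {x y z} → 2 ≤ x → 2 ≤ z → (x , y , z) ⟶ (0 , y , x + z)

-- An inhabitant of 𝒫-position p is a winning strategy for the player who has
-- just moved to p: a reply to every move q of the opponent, leading to a
-- position r from which the strategy continues.  Being inductive, it only
-- admits finite plays, and these end with the opponent unable to move.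
data 𝒫-position (p : Position) : Set where
  strategy : (∀ {q} → p ⟶ q → ∃ λ r → q ⟶ r × 𝒫-position r) → 𝒫-position p

P₀,₁ P₀,₂ N₀,₁ N₀,₂ : Pred Position 0ℓ
P₀,₁ (x , y , z) = x + y ≡ z × x ≤ z × y ≤ z × x ⊕ y ⊕ z ≡ 0 × x ⊓ y < 2
P₀,₂ (x , y , z) = x + y > z + 2 × x ≤ z × y ≤ z × x ⊕ y ⊕ z ≡ 0
N₀,₁ (x , y , z) = x + y ≡ z × x ≤ z × y ≤ z × x ⊕ y ⊕ z ≡ 0 × 2 ≤ x × 2 ≤ y
N₀,₂ (x , y , z) = x + y ≡ z + 2 × x ≤ z × y ≤ z × x ⊕ y ⊕ z ≡ 0

-- The set of all (x , y , z + 1) with x + y even and all (x , y , z - 1) with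
-- x + y odd, for (x , y , z) ∈ N.  The subtraction is that of the integers, so
-- a triple with z = 0 contributes nothing in the odd case.
data Shift (N : Pred Position 0ℓ) : Pred Position 0ℓ where
  even : ∀ {x y z} → 2 ∣ x + y → (x , y , z) ∈ N → (x , y , suc z) ∈ Shift N
  odd  : ∀ {x y z} → 2 ∤ x + y → (x , y , suc z) ∈ N → (x , y , z) ∈ Shift N

P₁,₁ P₁,₂ : Pred Position 0ℓ
P₁,₁ = Shift N₀,₁
P₁,₂ = Shift N₀,₂

SomeArrangement : Pred Position 0ℓ → Pred Position 0ℓ
SomeArrangement A (x , y , z) =
  (x , y , z) ∈ A ⊎ (x , z , y) ∈ A ⊎ (y , z , x) ∈ A

P₀ P₁ P : Pred Position 0ℓ
P₀ = SomeArrangement (P₀,₁ ∪ P₀,₂)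
P₁ = SomeArrangement (P₁,₁ ∪ P₁,₂)
P  = P₀ ∪ P₁

{-# OPTIONS --safe #-}
-- Halve all three piles.  A position belongs to P exactly when x ⊕ y ⊕ z is 1
-- or 0 according to whether the halves split, that is, are positive with one
-- the sum of the other two.  In both cases the halves have nim-sum 0, so no
-- removal leads from P to P.  An amalgamation leading to P leaves two equal
-- piles, hence starts at x + y ≡ z; if the halves have nim-sum 0 they then
-- split, but x ⊕ y ⊕ (x + y) is even.  Conversely, from a position outside P
-- ordinary Nim on the halves leads to P when their nim-sum is nonzero;
-- otherwise removing one stone from an odd pile does, and if all piles are
-- even then the halves split and the amalgamation of the two smaller piles
-- leads to P.
module Submission where

open import Defs
open import Data.Bool.Base using (true; false; if_then_else_)
open import Data.Digit using (Bit; Expansion; toDigits; fromDigits)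
open import Data.Fin.Base using (zero; suc; toℕ)
open import Data.List.Base using ([]; _∷_; drop)
open import Data.List.Properties using (map-id; alignWith-comm)
open import Data.Nat.Base
open import Data.Nat.Divisibility using (_∣_; divides)
open import Data.Nat.Induction using (<-wellFounded)
open import Data.Nat.Properties
open import Data.Parity.Base using (0ℙ; 1ℙ)
open import Data.Product.Base using (∃; _×_; _,_; proj₁; proj₂)
open import Data.Sum.Base using (_⊎_; inj₁; inj₂; [_,_]′)
open import Data.These.Base using (this; that; these)
open import Function.Base using (id; _∘_)
open import Function.Bundles using (_⇔_; mk⇔)
open import Induction.WellFounded using (Acc; acc)
open import Level using (0ℓ)
open import Relation.Binary.Definitions using (tri<; tri≈; tri>)
open import Relation.Binary.PropositionalEquality
open import Relation.Nullary using (¬_; Dec; yes; no; contradiction)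
open import Relation.Nullary.Decidable
  using (does; _×-dec_; _⊎-dec_; dec-true; dec-false; does-⇔)
open import Relation.Unary using (Pred; _∈_; _∪_)
import Data.Parity.Base as ℙ
import Data.Parity.Properties as ℙ
import Data.Sum.Base as Sum

-- Halves and parities

-- Each halving strips one binary digit, so facts about nim-sum can be proved from halves and last
-- bits alone.
½-rec : (A : Pred ℕ 0ℓ) → A 0 → (∀ n → A ⌊ n /2⌋ → A n) → ∀ n → A n
½-rec A base step n = go n (<-wellFounded n)
  where
  go : ∀ n → Acc _<_ n → A n
  go zero    _         = base
  go (suc n) (acc rec) = step (suc n) (go _ (rec (⌊n/2⌋<n n)))

½-parity-injective : ∀ m n → ⌊ m /2⌋ ≡ ⌊ n /2⌋ → parity m ≡ parity n → m ≡ n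
½-parity-injective 0 0 _ _ = refl
½-parity-injective 0 1 _ ()
½-parity-injective 1 1 _ _ = refl
½-parity-injective (suc (suc m)) (suc (suc n)) h p =
  cong (2 +_) (½-parity-injective m n (suc-injective h) p)

½-parity-≤ : ∀ m n → ⌊ m /2⌋ ≤ ⌊ n /2⌋ → parity m ≡ parity n → m ≤ n
½-parity-≤ 0 n _ _ = z≤n
½-parity-≤ 1 (suc n) _ _ = s≤s z≤n
½-parity-≤ (suc (suc m)) (suc (suc n)) (s≤s h) p = s≤s (s≤s (½-parity-≤ m n h p))

½-cancel-< : ∀ {m n} → ⌊ m /2⌋ < ⌊ n /2⌋ → m < n
½-cancel-< h = ≰⇒> λ n≤m → <⇒≱ h (⌊n/2⌋-mono n≤m)

-- Equal halves leave only the last bit to differ, and `n` has it set.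
½≡∧odd⇒≤ : ∀ m n → ⌊ m /2⌋ ≡ ⌊ n /2⌋ → parity n ≡ 1ℙ → m ≤ n
½≡∧odd⇒≤ 0 n _ _ = z≤n
½≡∧odd⇒≤ 1 (suc n) _ _ = s≤s z≤n
½≡∧odd⇒≤ (suc (suc m)) (suc (suc n)) h p =
  s≤s (s≤s (½≡∧odd⇒≤ m n (suc-injective h) p))

½-superadditive : ∀ m n → ⌊ m /2⌋ + ⌊ n /2⌋ ≤ ⌊ m + n /2⌋
½-superadditive 0 n = ≤-refl
½-superadditive 1 n = ⌊n/2⌋-mono (n≤1+n n)
½-superadditive (suc (suc m)) n = s≤s (½-superadditive m n)

-- The extra one accounts for a carry out of the last bits.
⌊m+n/2⌋≤1+⌊m/2⌋+⌊n/2⌋ : ∀ m n → ⌊ m + n /2⌋ ≤ suc (⌊ m /2⌋ + ⌊ n /2⌋)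
⌊m+n/2⌋≤1+⌊m/2⌋+⌊n/2⌋ 0 n = n≤1+n _
⌊m+n/2⌋≤1+⌊m/2⌋+⌊n/2⌋ 1 n = ⌊n/2⌋-mono (n≤1+n (suc n))
⌊m+n/2⌋≤1+⌊m/2⌋+⌊n/2⌋ (suc (suc m)) n = s≤s (⌊m+n/2⌋≤1+⌊m/2⌋+⌊n/2⌋ m n)

even⇒½-additive : ∀ m n → parity m ≡ 0ℙ → ⌊ m + n /2⌋ ≡ ⌊ m /2⌋ + ⌊ n /2⌋
even⇒½-additive 0 n _ = refl
even⇒½-additive (suc (suc m)) n p = cong suc (even⇒½-additive m n p)

2≤n⇒0<½n : ∀ {n} → 2 ≤ n → 0 < ⌊ n /2⌋
2≤n⇒0<½n = ⌊n/2⌋-mono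

0<½n⇒2≤n : ∀ {n} → 0 < ⌊ n /2⌋ → 2 ≤ n
0<½n⇒2≤n {suc (suc n)} _ = s≤s (s≤s z≤n)

½≡0∧even⇒≡0 : ∀ n → ⌊ n /2⌋ ≡ 0 → parity n ≡ 0ℙ → n ≡ 0
½≡0∧even⇒≡0 n = ½-parity-injective n 0

even-suc : ∀ n → parity n ≡ 0ℙ → parity (suc n) ≡ 1ℙ × ⌊ suc n /2⌋ ≡ ⌊ n /2⌋
even-suc 0 _ = refl , refl
even-suc (suc (suc n)) p with q , h ← even-suc n p = q , cong suc h

odd-suc : ∀ n → parity (suc n) ≡ 1ℙ → parity n ≡ 0ℙ
odd-suc 0 _ = refl
odd-suc (suc (suc n)) p = odd-suc n p

-- Equal parity rules out the middle value `1 + m`.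
m≤n≤2+m⇒n≡m⊎n≡2+m : ∀ {m n} → parity n ≡ parity m → m ≤ n → n ≤ 2 + m →
                     n ≡ m ⊎ n ≡ 2 + m
m≤n≤2+m⇒n≡m⊎n≡2+m {0} {0} _ _ _ = inj₁ refl
m≤n≤2+m⇒n≡m⊎n≡2+m {0} {2} _ _ _ = inj₂ refl
m≤n≤2+m⇒n≡m⊎n≡2+m {0} {suc (suc (suc n))} _ _ (s≤s (s≤s ()))
m≤n≤2+m⇒n≡m⊎n≡2+m {1} {1} _ _ _ = inj₁ refl
m≤n≤2+m⇒n≡m⊎n≡2+m {1} {3} _ _ _ = inj₂ refl
m≤n≤2+m⇒n≡m⊎n≡2+m {1} {suc (suc (suc (suc n)))} _ _ (s≤s (s≤s (s≤s ())))
m≤n≤2+m⇒n≡m⊎n≡2+m {suc (suc m)} {suc (suc n)} p (s≤s (s≤s l)) (s≤s (s≤s u)) =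
  [ inj₁ ∘ cong (2 +_) , inj₂ ∘ cong (2 +_) ]′ (m≤n≤2+m⇒n≡m⊎n≡2+m p l u)

2∣⇒even : ∀ {n} → 2 ∣ n → parity n ≡ 0ℙ
2∣⇒even (divides q refl) = trans (ℙ.*-homo-* q 2) (ℙ.*-zeroʳ (parity q))

even⇒2∣ : ∀ n → parity n ≡ 0ℙ → 2 ∣ n
even⇒2∣ 0 _ = divides 0 refl
even⇒2∣ (suc (suc n)) p with divides q eq ← even⇒2∣ n p =
  divides (suc q) (cong (2 +_) eq)

2∤⇒odd : ∀ n → ¬ 2 ∣ n → parity n ≡ 1ℙ
2∤⇒odd n 2∤n with parity n in pn
... | 0ℙ = contradiction (even⇒2∣ n pn) 2∤n
... | 1ℙ = refl

-- Nim-sum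

xor-comm : ∀ b c → b xor c ≡ c xor b
xor-comm zero       zero       = refl
xor-comm zero       (suc zero) = refl
xor-comm (suc zero) zero       = refl
xor-comm (suc zero) (suc zero) = refl

xorₑ-comm : ∀ ds es → ds xorₑ es ≡ es xorₑ ds
xorₑ-comm = alignWith-comm λ where
  (this _)    → refl
  (that _)    → refl
  (these b c) → xor-comm c b

½-∷ : ∀ (b : Bit) m → ⌊ toℕ b + m * 2 /2⌋ ≡ m
½-∷ zero       zero    = refl
½-∷ (suc zero) zero    = refl
½-∷ zero       (suc m) = cong suc (½-∷ zero m)
½-∷ (suc zero) (suc m) = cong suc (½-∷ (suc zero) m)

parity-∷ : ∀ (b : Bit) m → parity (toℕ b + m * 2) ≡ parity (toℕ b)
parity-∷ zero       zero    = refl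
parity-∷ (suc zero) zero    = refl
parity-∷ zero       (suc m) = parity-∷ zero m
parity-∷ (suc zero) (suc m) = parity-∷ (suc zero) m

parity-xor : ∀ b c → parity (toℕ (b xor c)) ≡ parity (toℕ b) ℙ.+ parity (toℕ c)
parity-xor zero       c          = refl
parity-xor (suc zero) zero       = refl
parity-xor (suc zero) (suc zero) = refl

½-fromDigits : ∀ (ds : Expansion 2) → ⌊ fromDigits ds /2⌋ ≡ fromDigits (drop 1 ds)
½-fromDigits []       = refl
½-fromDigits (d ∷ ds) = ½-∷ d (fromDigits ds)

drop-xorₑ : ∀ ds es → drop 1 (ds xorₑ es) ≡ drop 1 ds xorₑ drop 1 es
drop-xorₑ []           []       = refl
drop-xorₑ []           (e ∷ es) = refl
drop-xorₑ (d ∷ [])     []       = refl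
drop-xorₑ (d ∷ _ ∷ ds) []       = refl
drop-xorₑ (d ∷ ds)     (e ∷ es) = refl

parity-xorₑ : ∀ ds es → parity (fromDigits (ds xorₑ es)) ≡
              parity (fromDigits ds) ℙ.+ parity (fromDigits es)
parity-xorₑ [] es = cong (parity ∘ fromDigits) (map-id es)
parity-xorₑ ds@(_ ∷ _) [] =
  trans (cong (parity ∘ fromDigits) (map-id ds)) (sym (ℙ.+-identityʳ _))
parity-xorₑ (d ∷ ds) (e ∷ es)
  rewrite parity-∷ (d xor e) (fromDigits (ds xorₑ es))
        | parity-∷ d (fromDigits ds) | parity-∷ e (fromDigits es) = parity-xor d e

-- Expansions may have zeros at the top, so value zero does not force `ds` to be `[]`.
xorₑ-zeroˡ : ∀ ds es → fromDigits ds ≡ 0 → fromDigits (ds xorₑ es) ≡ fromDigits es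
xorₑ-zeroˡ []          es       _  = cong fromDigits (map-id es)
xorₑ-zeroˡ ds@(_ ∷ _)  []       eq = trans (cong fromDigits (map-id ds)) eq
xorₑ-zeroˡ (zero ∷ ds) (e ∷ es) eq =
  cong (λ n → toℕ e + n * 2) (xorₑ-zeroˡ ds es (m*n≡0⇒m≡0 _ 2 eq))

∷-injective : ∀ (b c : Bit) m n → toℕ b + m * 2 ≡ toℕ c + n * 2 → b ≡ c × m ≡ n
∷-injective b c m n eq =
  bits b c (trans (sym (parity-∷ b m)) (trans (cong parity eq) (parity-∷ c n))) ,
  trans (sym (½-∷ b m)) (trans (cong ⌊_/2⌋ eq) (½-∷ c n))
  where
  bits : ∀ (b c : Bit) → parity (toℕ b) ≡ parity (toℕ c) → b ≡ c
  bits zero       zero       _ = refl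
  bits zero       (suc zero) ()
  bits (suc zero) (suc zero) _ = refl

xorₑ-congˡ : ∀ ds ds′ es → fromDigits ds ≡ fromDigits ds′ →
             fromDigits (ds xorₑ es) ≡ fromDigits (ds′ xorₑ es)
xorₑ-congˡ [] ds′ es eq =
  trans (xorₑ-zeroˡ [] es refl) (sym (xorₑ-zeroˡ ds′ es (sym eq)))
xorₑ-congˡ ds@(_ ∷ _) [] es eq =
  trans (xorₑ-zeroˡ ds es eq) (sym (xorₑ-zeroˡ [] es refl))
xorₑ-congˡ ds@(_ ∷ _) ds′@(_ ∷ _) [] eq =
  trans (cong fromDigits (map-id ds)) (trans eq (sym (cong fromDigits (map-id ds′))))
xorₑ-congˡ (d ∷ ds) (d′ ∷ ds′) (e ∷ es) eq
  with refl , eq′ ← ∷-injective d d′ (fromDigits ds) (fromDigits ds′) eq =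
  cong (λ n → toℕ (d xor e) + n * 2) (xorₑ-congˡ ds ds′ es eq′)

-- For halving a nim-sum: `drop 1 (digits n)` and `digits ⌊ n /2⌋` are known only to have equal
-- values.
xorₑ-cong : ∀ ds ds′ es es′ → fromDigits ds ≡ fromDigits ds′ →
            fromDigits es ≡ fromDigits es′ →
            fromDigits (ds xorₑ es) ≡ fromDigits (ds′ xorₑ es′)
xorₑ-cong ds ds′ es es′ p q = begin
  fromDigits (ds xorₑ es)   ≡⟨ xorₑ-congˡ ds ds′ es p ⟩
  fromDigits (ds′ xorₑ es)  ≡⟨ cong fromDigits (xorₑ-comm ds′ es) ⟩
  fromDigits (es xorₑ ds′)  ≡⟨ xorₑ-congˡ es es′ ds′ q ⟩
  fromDigits (es′ xorₑ ds′) ≡⟨ cong fromDigits (xorₑ-comm es′ ds′) ⟩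
  fromDigits (ds′ xorₑ es′) ∎
  where open ≡-Reasoning

digits : ℕ → Expansion 2
digits n = proj₁ (toDigits 2 n)

fromDigits-digits : ∀ n → fromDigits (digits n) ≡ n
fromDigits-digits n = proj₂ (toDigits 2 n)

½-digits : ∀ n → fromDigits (drop 1 (digits n)) ≡ fromDigits (digits ⌊ n /2⌋)
½-digits n = begin
  fromDigits (drop 1 (digits n))    ≡⟨ ½-fromDigits (digits n) ⟨
  ⌊ fromDigits (digits n) /2⌋       ≡⟨ cong ⌊_/2⌋ (fromDigits-digits n) ⟩
  ⌊ n /2⌋                           ≡⟨ fromDigits-digits ⌊ n /2⌋ ⟨
  fromDigits (digits ⌊ n /2⌋)       ∎
  where open ≡-Reasoning

-- Nim-sum again, opaque because with-abstraction over goals that mention _⊕_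
-- unfolds it to digit expansions.
infixl 6 _⊻_

opaque
  _⊻_ : ℕ → ℕ → ℕ
  _⊻_ = _⊕_

  ⊻≡⊕ : ∀ m n → m ⊻ n ≡ m ⊕ n
  ⊻≡⊕ m n = refl

  -- Digit columns are independent, so halving just drops the lowest one. Together with `parity-⊻`
  -- this determines nim-sum recursively, without digit lists.
  ½-⊻ : ∀ m n → ⌊ m ⊻ n /2⌋ ≡ ⌊ m /2⌋ ⊻ ⌊ n /2⌋
  ½-⊻ m n = begin
    ⌊ m ⊻ n /2⌋
      ≡⟨ ½-fromDigits (digits m xorₑ digits n) ⟩
    fromDigits (drop 1 (digits m xorₑ digits n))
      ≡⟨ cong fromDigits (drop-xorₑ (digits m) (digits n)) ⟩
    fromDigits (drop 1 (digits m) xorₑ drop 1 (digits n))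
      ≡⟨ xorₑ-cong (drop 1 (digits m)) (digits ⌊ m /2⌋) (drop 1 (digits n)) (digits ⌊ n /2⌋)
             (½-digits m) (½-digits n) ⟩
    ⌊ m /2⌋ ⊻ ⌊ n /2⌋ ∎
    where open ≡-Reasoning

  parity-⊻ : ∀ m n → parity (m ⊻ n) ≡ parity m ℙ.+ parity n
  parity-⊻ m n = trans (parity-xorₑ (digits m) (digits n))
    (cong₂ (λ a b → parity a ℙ.+ parity b) (fromDigits-digits m) (fromDigits-digits n))

  ⊻-identityˡ : ∀ n → 0 ⊻ n ≡ n
  ⊻-identityˡ n = trans (xorₑ-zeroˡ (digits 0) (digits n) refl) (fromDigits-digits n)

  ⊻-comm : ∀ m n → m ⊻ n ≡ n ⊻ m
  ⊻-comm m n = cong fromDigits (xorₑ-comm (digits m) (digits n))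

-- Algebra of nim-sum

½-⊻₃ : ∀ x y z → ⌊ x ⊻ y ⊻ z /2⌋ ≡ ⌊ x /2⌋ ⊻ ⌊ y /2⌋ ⊻ ⌊ z /2⌋
½-⊻₃ x y z = trans (½-⊻ (x ⊻ y) z) (cong (_⊻ ⌊ z /2⌋) (½-⊻ x y))

parity-⊻₃ : ∀ x y z → parity (x ⊻ y ⊻ z) ≡ parity x ℙ.+ parity y ℙ.+ parity z
parity-⊻₃ x y z = trans (parity-⊻ (x ⊻ y) z) (cong (ℙ._+ parity z) (parity-⊻ x y))

⊻-identityʳ : ∀ n → n ⊻ 0 ≡ n
⊻-identityʳ n = trans (⊻-comm n 0) (⊻-identityˡ n)

⊻-self : ∀ n → n ⊻ n ≡ 0
⊻-self = ½-rec _ (⊻-identityˡ 0) λ n ih → ½≡0∧even⇒≡0 (n ⊻ n)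
  (trans (½-⊻ n n) ih) (trans (parity-⊻ n n) (ℙ.p+p≡0ℙ (parity n)))

-- The recursion follows `x`, but halving acts on all three arguments, so `y` and `z` stay
-- universally quantified.
⊻-assoc : ∀ x y z → (x ⊻ y) ⊻ z ≡ x ⊻ (y ⊻ z)
⊻-assoc = ½-rec _ base step
  where
  base : ∀ y z → (0 ⊻ y) ⊻ z ≡ 0 ⊻ (y ⊻ z)
  base y z = trans (cong (_⊻ z) (⊻-identityˡ y)) (sym (⊻-identityˡ (y ⊻ z)))

  step : ∀ x → (∀ y z → (⌊ x /2⌋ ⊻ y) ⊻ z ≡ ⌊ x /2⌋ ⊻ (y ⊻ z)) →
         ∀ y z → (x ⊻ y) ⊻ z ≡ x ⊻ (y ⊻ z)
  step x ih y z = ½-parity-injective ((x ⊻ y) ⊻ z) (x ⊻ (y ⊻ z)) half par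
    where
    open ≡-Reasoning

    half : ⌊ (x ⊻ y) ⊻ z /2⌋ ≡ ⌊ x ⊻ (y ⊻ z) /2⌋
    half = begin
      ⌊ (x ⊻ y) ⊻ z /2⌋                 ≡⟨ ½-⊻₃ x y z ⟩
      (⌊ x /2⌋ ⊻ ⌊ y /2⌋) ⊻ ⌊ z /2⌋     ≡⟨ ih ⌊ y /2⌋ ⌊ z /2⌋ ⟩
      ⌊ x /2⌋ ⊻ (⌊ y /2⌋ ⊻ ⌊ z /2⌋)     ≡⟨ cong (⌊ x /2⌋ ⊻_) (½-⊻ y z) ⟨
      ⌊ x /2⌋ ⊻ ⌊ y ⊻ z /2⌋             ≡⟨ ½-⊻ x (y ⊻ z) ⟨
      ⌊ x ⊻ (y ⊻ z) /2⌋                 ∎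

    par : parity ((x ⊻ y) ⊻ z) ≡ parity (x ⊻ (y ⊻ z))
    par = begin
      parity ((x ⊻ y) ⊻ z)                    ≡⟨ parity-⊻₃ x y z ⟩
      (parity x ℙ.+ parity y) ℙ.+ parity z
        ≡⟨ ℙ.+-assoc (parity x) (parity y) (parity z) ⟩
      parity x ℙ.+ (parity y ℙ.+ parity z)    ≡⟨ cong (parity x ℙ.+_) (parity-⊻ y z) ⟨
      parity x ℙ.+ parity (y ⊻ z)             ≡⟨ parity-⊻ x (y ⊻ z) ⟨
      parity (x ⊻ (y ⊻ z))                    ∎

⊻-cancel-middle : ∀ x y → x ⊻ (x ⊻ y) ≡ y
⊻-cancel-middle x y = begin
  x ⊻ (x ⊻ y) ≡⟨ ⊻-assoc x x y ⟨
  (x ⊻ x) ⊻ y ≡⟨ cong (_⊻ y) (⊻-self x) ⟩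
  0 ⊻ y       ≡⟨ ⊻-identityˡ y ⟩
  y           ∎
  where open ≡-Reasoning

⊻-transpose : ∀ {x y z} → x ⊻ y ≡ z → x ≡ y ⊻ z
⊻-transpose {x} {y} {z} eq = begin
  x             ≡⟨ ⊻-cancel-middle y x ⟨
  y ⊻ (y ⊻ x)   ≡⟨ cong (y ⊻_) (trans (⊻-comm y x) eq) ⟩
  y ⊻ z         ∎
  where open ≡-Reasoning

⊻-transpose₃ : ∀ {x y z s} → x ⊻ y ⊻ z ≡ s → x ≡ y ⊻ z ⊻ s
⊻-transpose₃ {x} {y} {z} eq = ⊻-transpose (trans (sym (⊻-assoc x y z)) eq)

⊻≡0⇒≡ : ∀ {x y} → x ⊻ y ≡ 0 → x ≡ y
⊻≡0⇒≡ {x} {y} eq = trans (⊻-transpose eq) (⊻-identityʳ y)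

⊻-swap₁₂ : ∀ x y z → x ⊻ y ⊻ z ≡ y ⊻ x ⊻ z
⊻-swap₁₂ x y z = cong (_⊻ z) (⊻-comm x y)

⊻-swap₂₃ : ∀ x y z → x ⊻ y ⊻ z ≡ x ⊻ z ⊻ y
⊻-swap₂₃ x y z = begin
  x ⊻ y ⊻ z   ≡⟨ ⊻-assoc x y z ⟩
  x ⊻ (y ⊻ z) ≡⟨ cong (x ⊻_) (⊻-comm y z) ⟩
  x ⊻ (z ⊻ y) ≡⟨ ⊻-assoc x z y ⟨
  x ⊻ z ⊻ y   ∎
  where open ≡-Reasoning

parity-+≡parity-⊻ : ∀ m n → parity (m + n) ≡ parity (m ⊻ n)
parity-+≡parity-⊻ m n = trans (ℙ.+-homo-+ m n) (sym (parity-⊻ m n))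

-- Nim-sum is addition without carries. Both sides have the same parity, so the comparison lifts
-- from the halves.
m⊻n≤m+n : ∀ m n → m ⊻ n ≤ m + n
m⊻n≤m+n = ½-rec _ (λ n → ≤-reflexive (⊻-identityˡ n)) λ m ih n →
  ½-parity-≤ (m ⊻ n) (m + n)
    (begin
      ⌊ m ⊻ n /2⌋         ≡⟨ ½-⊻ m n ⟩
      ⌊ m /2⌋ ⊻ ⌊ n /2⌋   ≤⟨ ih ⌊ n /2⌋ ⟩
      ⌊ m /2⌋ + ⌊ n /2⌋   ≤⟨ ½-superadditive m n ⟩
      ⌊ m + n /2⌋         ∎)
    (sym (parity-+≡parity-⊻ m n))
  where open ≤-Reasoning

-- Ordinary Nim with three piles

some-odd : ∀ x y z → (parity x ≡ 1ℙ ⊎ parity y ≡ 1ℙ ⊎ parity z ≡ 1ℙ) ⊎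
           (parity x ≡ 0ℙ × parity y ≡ 0ℙ × parity z ≡ 0ℙ)
some-odd x y z with parity x | parity y | parity z
... | 1ℙ | _  | _  = inj₁ (inj₁ refl)
... | 0ℙ | 1ℙ | _  = inj₁ (inj₂ (inj₁ refl))
... | 0ℙ | 0ℙ | 1ℙ = inj₁ (inj₂ (inj₂ refl))
... | 0ℙ | 0ℙ | 0ℙ = inj₂ (refl , refl , refl)

even⇒⊻₃-even : ∀ x y z → parity x ≡ 0ℙ × parity y ≡ 0ℙ × parity z ≡ 0ℙ →
               parity (x ⊻ y ⊻ z) ≡ 0ℙ
even⇒⊻₃-even x y z (even-x , even-y , even-z) =
  trans (parity-⊻₃ x y z) (cong₂ ℙ._+_ (cong₂ ℙ._+_ even-x even-y) even-z)

½-balanced : ∀ x y z → ⌊ x /2⌋ ⊻ ⌊ y /2⌋ ⊻ ⌊ z /2⌋ ≡ 0 → ⌊ y ⊻ z /2⌋ ≡ ⌊ x /2⌋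
½-balanced x y z bal = trans (½-⊻ y z)
  (sym (⊻≡0⇒≡ (trans (sym (⊻-assoc ⌊ x /2⌋ ⌊ y /2⌋ ⌊ z /2⌋)) bal)))

½≡∧odd⇒< : ∀ {m n} → ⌊ m /2⌋ ≡ ⌊ n /2⌋ → parity n ≡ 1ℙ → m ≢ n → m < n
½≡∧odd⇒< {m} {n} h p ne = ≤∧≢⇒< (½≡∧odd⇒≤ m n h p) ne

-- The winning moves of ordinary Nim: lowering a pile to the nim-sum of the other two makes the
-- total nim-sum zero.
Reducible : ℕ → ℕ → ℕ → Set
Reducible x y z = y ⊻ z < x ⊎ x ⊻ z < y ⊎ x ⊻ y < z

½-Reducible : ∀ x y z → Reducible ⌊ x /2⌋ ⌊ y /2⌋ ⌊ z /2⌋ →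
              ⌊ y ⊻ z /2⌋ < ⌊ x /2⌋ ⊎ ⌊ x ⊻ z /2⌋ < ⌊ y /2⌋ ⊎ ⌊ x ⊻ y /2⌋ < ⌊ z /2⌋
½-Reducible x y z = Sum.map (≤-<-trans (≤-reflexive (½-⊻ y z)))
  (Sum.map (≤-<-trans (≤-reflexive (½-⊻ x z))) (≤-<-trans (≤-reflexive (½-⊻ x y))))

-- By `½-balanced`, `y ⊻ z` has the same half as the odd `x`, hence is smaller unless equal;
-- equality would make the total nim-sum zero.
odd⇒reducible : ∀ x y z → ⌊ x /2⌋ ⊻ ⌊ y /2⌋ ⊻ ⌊ z /2⌋ ≡ 0 → parity x ≡ 1ℙ →
                x ⊻ y ⊻ z ≢ 0 → y ⊻ z < x
odd⇒reducible x y z bal odd-x ne = ½≡∧odd⇒< (½-balanced x y z bal) odd-x λ eq →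
  ne (trans (⊻-assoc x y z) (trans (cong (x ⊻_) eq) (⊻-self x)))

⊻-rotate : ∀ x y z → x ⊻ y ⊻ z ≡ z ⊻ x ⊻ y
⊻-rotate x y z = trans (⊻-comm (x ⊻ y) z) (sym (⊻-assoc z x y))

-- Bouton's lemma. If the halves already have nonzero nim-sum, a reduction of the halves lifts.
-- Otherwise the nim-sum is 1, so some pile is odd.
nonzero⇒reducible : ∀ x y z → x ⊻ y ⊻ z ≢ 0 → Reducible x y z
nonzero⇒reducible = ½-rec _ base step
  where
  base : ∀ y z → 0 ⊻ y ⊻ z ≢ 0 → Reducible 0 y z
  base y z ne with <-cmp y z
  ... | tri< y<z _ _ = inj₂ (inj₂ (subst (_< z) (sym (⊻-identityˡ y)) y<z))
  ... | tri≈ _ y≡z _ = contradiction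
          (trans (cong₂ _⊻_ (⊻-identityˡ y) (sym y≡z)) (⊻-self y)) ne
  ... | tri> _ _ z<y = inj₂ (inj₁ (subst (_< y) (sym (⊻-identityˡ z)) z<y))

  step : ∀ x → (∀ y z → ⌊ x /2⌋ ⊻ y ⊻ z ≢ 0 → Reducible ⌊ x /2⌋ y z) →
         ∀ y z → x ⊻ y ⊻ z ≢ 0 → Reducible x y z
  step x ih y z ne with ⌊ x /2⌋ ⊻ ⌊ y /2⌋ ⊻ ⌊ z /2⌋ ≟ 0
  step x ih y z ne | no ½ne with ½-Reducible x y z (ih _ _ ½ne)
  ... | inj₁ l        = inj₁ (½-cancel-< l)
  ... | inj₂ (inj₁ l) = inj₂ (inj₁ (½-cancel-< l))
  ... | inj₂ (inj₂ l) = inj₂ (inj₂ (½-cancel-< l))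
  step x ih y z ne | yes bal with some-odd x y z
  ... | inj₁ (inj₁ odd-x) = inj₁ (odd⇒reducible x y z bal odd-x ne)
  ... | inj₁ (inj₂ (inj₁ odd-y)) = inj₂ (inj₁ (odd⇒reducible y x z
        (trans (⊻-swap₁₂ ⌊ y /2⌋ ⌊ x /2⌋ ⌊ z /2⌋) bal) odd-y (ne ∘ trans (⊻-swap₁₂ x y z))))
  ... | inj₁ (inj₂ (inj₂ odd-z)) = inj₂ (inj₂ (odd⇒reducible z x y
        (trans (sym (⊻-rotate ⌊ x /2⌋ ⌊ y /2⌋ ⌊ z /2⌋)) bal) odd-z (ne ∘ trans (⊻-rotate x y z))))
  ... | inj₂ evens = contradiction
        (½≡0∧even⇒≡0 _ (trans (½-⊻₃ x y z) bal) (even⇒⊻₃-even x y z evens)) ne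

-- Balanced positions

Split : ℕ → ℕ → ℕ → Set
Split X Y Z = (0 < X × 0 < Y × 0 < Z) × (X + Y ≡ Z ⊎ X + Z ≡ Y ⊎ Y + Z ≡ X)

split? : ∀ X Y Z → Dec (Split X Y Z)
split? X Y Z = (0 <? X ×-dec 0 <? Y ×-dec 0 <? Z) ×-dec
               (X + Y ≟ Z ⊎-dec X + Z ≟ Y ⊎-dec Y + Z ≟ X)

Split-swap₁₂ : ∀ {X Y Z} → Split X Y Z → Split Y X Z
Split-swap₁₂ {X} {Y} ((a , b , c) , inj₁ e)        = (b , a , c) , inj₁ (trans (+-comm Y X) e)
Split-swap₁₂         ((a , b , c) , inj₂ (inj₁ e)) = (b , a , c) , inj₂ (inj₂ e)
Split-swap₁₂         ((a , b , c) , inj₂ (inj₂ e)) = (b , a , c) , inj₂ (inj₁ e)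

Split-swap₂₃ : ∀ {X Y Z} → Split X Y Z → Split X Z Y
Split-swap₂₃             ((a , b , c) , inj₁ e)        = (a , c , b) , inj₂ (inj₁ e)
Split-swap₂₃             ((a , b , c) , inj₂ (inj₁ e)) = (a , c , b) , inj₁ e
Split-swap₂₃ {_} {Y} {Z} ((a , b , c) , inj₂ (inj₂ e)) =
  (a , c , b) , inj₂ (inj₂ (trans (+-comm Z Y) e))

-- The nim-sum required of a position in `P`. It depends on the halves only, so it ignores the last
-- bits of the piles.
σ : ℕ → ℕ → ℕ → ℕ
σ X Y Z = if does (split? X Y Z) then 1 else 0

σ-split : ∀ {X Y Z} → Split X Y Z → σ X Y Z ≡ 1
σ-split {X} {Y} {Z} s = cong (if_then 1 else 0) (dec-true (split? X Y Z) s)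

σ-¬split : ∀ {X Y Z} → ¬ Split X Y Z → σ X Y Z ≡ 0
σ-¬split {X} {Y} {Z} ¬s = cong (if_then 1 else 0) (dec-false (split? X Y Z) ¬s)

½σ≡0 : ∀ X Y Z → ⌊ σ X Y Z /2⌋ ≡ 0
½σ≡0 X Y Z with does (split? X Y Z)
... | true  = refl
... | false = refl

σ-swap₁₂ : ∀ X Y Z → σ X Y Z ≡ σ Y X Z
σ-swap₁₂ X Y Z = cong (if_then 1 else 0)
  (does-⇔ (mk⇔ Split-swap₁₂ Split-swap₁₂) (split? X Y Z) (split? Y X Z))

σ-swap₂₃ : ∀ X Y Z → σ X Y Z ≡ σ X Z Y
σ-swap₂₃ X Y Z = cong (if_then 1 else 0)
  (does-⇔ (mk⇔ Split-swap₂₃ Split-swap₂₃) (split? X Y Z) (split? X Z Y))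

-- A formula for `P` that is decidable at once and symmetric in the three piles.
Balanced : Pred Position 0ℓ
Balanced (x , y , z) = x ⊻ y ⊻ z ≡ σ ⌊ x /2⌋ ⌊ y /2⌋ ⌊ z /2⌋

balanced? : ∀ p → Dec (Balanced p)
balanced? (x , y , z) = x ⊻ y ⊻ z ≟ σ ⌊ x /2⌋ ⌊ y /2⌋ ⌊ z /2⌋

swap₁₂ : ∀ x y z → Balanced (x , y , z) → Balanced (y , x , z)
swap₁₂ x y z b = trans (⊻-swap₁₂ y x z) (trans b (σ-swap₁₂ ⌊ x /2⌋ ⌊ y /2⌋ ⌊ z /2⌋))

swap₂₃ : ∀ x y z → Balanced (x , y , z) → Balanced (x , z , y)
swap₂₃ x y z b = trans (⊻-swap₂₃ x z y) (trans b (σ-swap₂₃ ⌊ x /2⌋ ⌊ y /2⌋ ⌊ z /2⌋))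

rotateˡ : ∀ x y z → Balanced (x , y , z) → Balanced (y , z , x)
rotateˡ x y z = swap₂₃ y x z ∘ swap₁₂ x y z

rotateʳ : ∀ x y z → Balanced (x , y , z) → Balanced (z , x , y)
rotateʳ x y z = swap₁₂ x z y ∘ swap₂₃ x y z

Balanced⇒½-balanced : ∀ x y z → Balanced (x , y , z) → ⌊ x /2⌋ ⊻ ⌊ y /2⌋ ⊻ ⌊ z /2⌋ ≡ 0
Balanced⇒½-balanced x y z b =
  trans (sym (½-⊻₃ x y z)) (trans (cong ⌊_/2⌋ b) (½σ≡0 ⌊ x /2⌋ ⌊ y /2⌋ ⌊ z /2⌋))

-- Sums of piles and sums of halves

-- The sum of the first two halves is at least their nim-sum `⌊ z /2⌋`, has the same parity, and
-- exceeds it by at most one; parity then excludes an excess of one.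
½-split : ∀ {x y z} → x ⊻ y ≡ z → x + y ≡ z ⊎ x + y ≡ 2 + z →
          ⌊ x /2⌋ + ⌊ y /2⌋ ≡ ⌊ z /2⌋
½-split {x} {y} {z} nim sum =
  [ id , (λ eq → contradiction (≤-trans (≤-reflexive (sym eq)) upper) (<-irrefl refl)) ]′
    (m≤n≤2+m⇒n≡m⊎n≡2+m same-parity lower (m≤n⇒m≤1+n upper))
  where
  ½nim : ⌊ x /2⌋ ⊻ ⌊ y /2⌋ ≡ ⌊ z /2⌋
  ½nim = trans (sym (½-⊻ x y)) (cong ⌊_/2⌋ nim)

  same-parity : parity (⌊ x /2⌋ + ⌊ y /2⌋) ≡ parity ⌊ z /2⌋
  same-parity = trans (parity-+≡parity-⊻ ⌊ x /2⌋ ⌊ y /2⌋) (cong parity ½nim)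

  lower : ⌊ z /2⌋ ≤ ⌊ x /2⌋ + ⌊ y /2⌋
  lower = subst (_≤ _) ½nim (m⊻n≤m+n ⌊ x /2⌋ ⌊ y /2⌋)

  upper : ⌊ x /2⌋ + ⌊ y /2⌋ ≤ suc ⌊ z /2⌋
  upper = ≤-trans (½-superadditive x y)
    ([ (λ eq → ≤-trans (≤-reflexive (cong ⌊_/2⌋ eq)) (n≤1+n _))
     , (λ eq → ≤-reflexive (cong ⌊_/2⌋ eq)) ]′ sum)

sum-cases : ∀ {x y z} → x ⊻ y ≡ z → x + y ≤ 2 + z → x + y ≡ z ⊎ x + y ≡ 2 + z
sum-cases {x} {y} nim upper = m≤n≤2+m⇒n≡m⊎n≡2+m
  (trans (parity-+≡parity-⊻ x y) (cong parity nim)) (subst (_≤ x + y) nim (m⊻n≤m+n x y)) upper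

-- Only a carry out of the last bits can separate `x + y` from `z`, which bounds the sum by `2 + z`.
½-split⇒sum-cases : ∀ {x y z} → x ⊻ y ≡ z → ⌊ x /2⌋ + ⌊ y /2⌋ ≡ ⌊ z /2⌋ →
                    x + y ≡ z ⊎ x + y ≡ 2 + z
½-split⇒sum-cases {x} {y} {z} nim split = sum-cases nim (½-parity-≤ _ _
  (≤-trans (⌊m+n/2⌋≤1+⌊m/2⌋+⌊n/2⌋ x y) (s≤s (≤-reflexive split)))
  (trans (parity-+≡parity-⊻ x y) (cong parity nim)))

Split-intro : ∀ {x y z} → 2 ≤ x → 2 ≤ y → ⌊ x /2⌋ + ⌊ y /2⌋ ≡ ⌊ z /2⌋ →
              Split ⌊ x /2⌋ ⌊ y /2⌋ ⌊ z /2⌋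
Split-intro {x} {y} {z} 2≤x 2≤y eq =
  (2≤n⇒0<½n 2≤x , 2≤n⇒0<½n 2≤y , ≤-trans (2≤n⇒0<½n 2≤x) (subst (_ ≤_) eq (m≤m+n _ _))) ,
  inj₁ eq

Split-zero₂ : ∀ X Z → ¬ Split X 0 Z
Split-zero₂ X Z ((_ , () , _) , _)

-- The game

-- The other two piles determine the half of the remaining one, hence the value of `σ`, hence the
-- pile itself.
removal-unbalances : ∀ x u y z → Balanced (x , y , z) → Balanced (u , y , z) → x ≡ u
removal-unbalances x u y z bx bu = begin
  x                                   ≡⟨ ⊻-transpose₃ bx ⟩
  y ⊻ z ⊻ σ ⌊ x /2⌋ ⌊ y /2⌋ ⌊ z /2⌋   ≡⟨ cong (λ X → y ⊻ z ⊻ σ X ⌊ y /2⌋ ⌊ z /2⌋) ½x≡½u ⟩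
  y ⊻ z ⊻ σ ⌊ u /2⌋ ⌊ y /2⌋ ⌊ z /2⌋   ≡⟨ ⊻-transpose₃ bu ⟨
  u                                   ∎
  where
  open ≡-Reasoning
  ½x≡½u : ⌊ x /2⌋ ≡ ⌊ u /2⌋
  ½x≡½u = trans (sym (½-balanced x y z (Balanced⇒½-balanced x y z bx)))
                (½-balanced u y z (Balanced⇒½-balanced u y z bu))

merge-unbalances : ∀ x y z → 2 ≤ x → 2 ≤ y → Balanced (x , y , z) →
                   ¬ Balanced (x + y , 0 , z)
merge-unbalances x y z 2≤x 2≤y b m = contradiction (trans (sym even-sum) odd-sum) λ ()
  where
  open ≡-Reasoning

  x+y≡z : x + y ≡ z
  x+y≡z = ⊻≡0⇒≡ (begin
    (x + y) ⊻ z               ≡⟨ cong (_⊻ z) (⊻-identityʳ (x + y)) ⟨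
    (x + y) ⊻ 0 ⊻ z           ≡⟨ m ⟩
    σ ⌊ x + y /2⌋ 0 ⌊ z /2⌋   ≡⟨ σ-¬split (Split-zero₂ ⌊ x + y /2⌋ ⌊ z /2⌋) ⟩
    0                         ∎)

  ½nim : ⌊ x /2⌋ ⊻ ⌊ y /2⌋ ≡ ⌊ z /2⌋
  ½nim = ⊻≡0⇒≡ (Balanced⇒½-balanced x y z b)

  -- Superadditivity of halving bounds the sum of the halves from above, and its nim-sum from below,
  -- both by `⌊ z /2⌋`.
  split : ⌊ x /2⌋ + ⌊ y /2⌋ ≡ ⌊ z /2⌋
  split = ≤-antisym (subst (λ n → _ ≤ ⌊ n /2⌋) x+y≡z (½-superadditive x y))
                    (subst (_≤ _) ½nim (m⊻n≤m+n ⌊ x /2⌋ ⌊ y /2⌋))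

  odd-sum : parity (x ⊻ y ⊻ z) ≡ 1ℙ
  odd-sum = cong parity (trans b (σ-split (Split-intro 2≤x 2≤y split)))

  even-sum : parity (x ⊻ y ⊻ z) ≡ 0ℙ
  even-sum = begin
    parity (x ⊻ y ⊻ z)            ≡⟨ parity-⊻ (x ⊻ y) z ⟩
    parity (x ⊻ y) ℙ.+ parity z   ≡⟨ cong (ℙ._+ parity z) (parity-+≡parity-⊻ x y) ⟨
    parity (x + y) ℙ.+ parity z   ≡⟨ cong (λ n → parity n ℙ.+ parity z) x+y≡z ⟩
    parity z ℙ.+ parity z         ≡⟨ ℙ.p+p≡0ℙ (parity z) ⟩
    0ℙ                            ∎

-- By symmetry of `Balanced`, every move becomes a removal from the first pile or a merge of the
-- first two into the first.
move-unbalances : ∀ {p q} → p ⟶ q → Balanced p → ¬ Balanced q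
move-unbalances (remove₁ {x} {y} {z} {u} u<x) b c =
  <⇒≢ u<x (sym (removal-unbalances x u y z b c))
move-unbalances (remove₂ {x} {y} {z} {v} v<y) b c =
  <⇒≢ v<y (sym (removal-unbalances y v x z (swap₁₂ x y z b) (swap₁₂ x v z c)))
move-unbalances (remove₃ {x} {y} {z} {w} w<z) b c =
  <⇒≢ w<z (sym (removal-unbalances z w x y (rotateʳ x y z b) (rotateʳ x y w c)))
move-unbalances (merge₁₂ˡ {x} {y} {z} 2≤x 2≤y) b c = merge-unbalances x y z 2≤x 2≤y b c
move-unbalances (merge₁₂ʳ {x} {y} {z} 2≤x 2≤y) b c =
  merge-unbalances x y z 2≤x 2≤y b (swap₁₂ 0 (x + y) z c)
move-unbalances (merge₂₃ˡ {x} {y} {z} 2≤y 2≤z) b c =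
  merge-unbalances y z x 2≤y 2≤z (rotateˡ x y z b) (rotateˡ x (y + z) 0 c)
move-unbalances (merge₂₃ʳ {x} {y} {z} 2≤y 2≤z) b c =
  merge-unbalances y z x 2≤y 2≤z (rotateˡ x y z b)
    (swap₁₂ 0 (y + z) x (rotateˡ x 0 (y + z) c))
move-unbalances (merge₁₃ˡ {x} {y} {z} 2≤x 2≤z) b c =
  merge-unbalances x z y 2≤x 2≤z (swap₂₃ x y z b) (swap₂₃ (x + z) y 0 c)
move-unbalances (merge₁₃ʳ {x} {y} {z} 2≤x 2≤z) b c =
  merge-unbalances x z y 2≤x 2≤z (swap₂₃ x y z b) (rotateʳ 0 y (x + z) c)

-- The requirement u ≡ y ⊻ z ⊻ σ ⌊ u /2⌋ ⌊ y /2⌋ ⌊ z /2⌋ is not circular: the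
-- value of σ does not affect ⌊ u /2⌋.
rebalance : ∀ y z → ∃ λ (u : ℕ) → ⌊ u /2⌋ ≡ ⌊ y ⊻ z /2⌋ × Balanced (u , y , z)
rebalance y z = u , ½u , bal
  where
  open ≡-Reasoning

  s u : ℕ
  s = σ ⌊ y ⊻ z /2⌋ ⌊ y /2⌋ ⌊ z /2⌋
  u = y ⊻ z ⊻ s

  ½u : ⌊ u /2⌋ ≡ ⌊ y ⊻ z /2⌋
  ½u = begin
    ⌊ u /2⌋                 ≡⟨ ½-⊻ (y ⊻ z) s ⟩
    ⌊ y ⊻ z /2⌋ ⊻ ⌊ s /2⌋   ≡⟨ cong (⌊ y ⊻ z /2⌋ ⊻_) (½σ≡0 ⌊ y ⊻ z /2⌋ _ _) ⟩
    ⌊ y ⊻ z /2⌋ ⊻ 0         ≡⟨ ⊻-identityʳ _ ⟩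
    ⌊ y ⊻ z /2⌋             ∎

  bal : Balanced (u , y , z)
  bal = begin
    u ⊻ y ⊻ z                   ≡⟨ ⊻-assoc u y z ⟩
    u ⊻ (y ⊻ z)                 ≡⟨ ⊻-comm u (y ⊻ z) ⟩
    (y ⊻ z) ⊻ u                 ≡⟨ ⊻-cancel-middle (y ⊻ z) s ⟩
    s                           ≡⟨ cong (λ X → σ X ⌊ y /2⌋ ⌊ z /2⌋) ½u ⟨
    σ ⌊ u /2⌋ ⌊ y /2⌋ ⌊ z /2⌋   ∎

-- Replies from unbalanced positions

Removal : ℕ → ℕ → ℕ → Set
Removal x y z = ∃ λ (u : ℕ) → u < x × Balanced (u , y , z)

-- A Nim move on the halves already makes the pile smaller, so `rebalance` is free to choose its
-- last bit.
½<⇒Removal : ∀ x y z → ⌊ y ⊻ z /2⌋ < ⌊ x /2⌋ → Removal x y z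
½<⇒Removal x y z l with u , ½u , b ← rebalance y z =
  u , ½-cancel-< (subst (_< ⌊ x /2⌋) (sym ½u) l) , b

-- The balancing pile has the same half as the odd `x`, so it is `x` or one less; the position being
-- unbalanced excludes `x`.
odd⇒Removal : ∀ x y z → ⌊ x /2⌋ ⊻ ⌊ y /2⌋ ⊻ ⌊ z /2⌋ ≡ 0 → parity x ≡ 1ℙ →
              ¬ Balanced (x , y , z) → Removal x y z
odd⇒Removal x y z bal odd-x ¬b with u , ½u , b ← rebalance y z =
  u , ½≡∧odd⇒< (trans ½u (½-balanced x y z bal)) odd-x (λ { refl → ¬b b }) , b

Reply : Pred Position 0ℓ
Reply p = ∃ λ q → p ⟶ q × Balanced q

remove-from₁ : ∀ x y z → Removal x y z → Reply (x , y , z)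
remove-from₁ x y z (u , u<x , b) = _ , remove₁ u<x , b

remove-from₂ : ∀ x y z → Removal y x z → Reply (x , y , z)
remove-from₂ x y z (v , v<y , b) = _ , remove₂ v<y , swap₁₂ v x z b

remove-from₃ : ∀ x y z → Removal z x y → Reply (x , y , z)
remove-from₃ x y z (w , w<z , b) = _ , remove₃ w<z , rotateˡ w x y b

evens⇒x+y≡z : ∀ x y z → parity x ≡ 0ℙ → parity y ≡ 0ℙ → parity z ≡ 0ℙ →
              ⌊ x /2⌋ + ⌊ y /2⌋ ≡ ⌊ z /2⌋ → x + y ≡ z
evens⇒x+y≡z x y z px py pz split = ½-parity-injective (x + y) z
  (trans (even⇒½-additive x y px) split)
  (trans (ℙ.+-homo-+ x y) (trans (cong₂ ℙ._+_ px py) (sym pz)))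

merged-balanced : ∀ x y {z} → x + y ≡ z → Balanced (x + y , 0 , z)
merged-balanced x y refl = begin
  (x + y) ⊻ 0 ⊻ (x + y)           ≡⟨ cong (_⊻ (x + y)) (⊻-identityʳ (x + y)) ⟩
  (x + y) ⊻ (x + y)               ≡⟨ ⊻-self (x + y) ⟩
  0                               ≡⟨ σ-¬split (Split-zero₂ ⌊ x + y /2⌋ ⌊ x + y /2⌋) ⟨
  σ ⌊ x + y /2⌋ 0 ⌊ x + y /2⌋     ∎
  where open ≡-Reasoning

-- With even piles the splitting of the halves carries over to the piles, so the merge leaves two
-- equal piles and an empty one.
split⇒Reply : ∀ x y z → parity x ≡ 0ℙ × parity y ≡ 0ℙ × parity z ≡ 0ℙ →
              Split ⌊ x /2⌋ ⌊ y /2⌋ ⌊ z /2⌋ → Reply (x , y , z)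
split⇒Reply x y z (px , py , pz) ((a , b , c) , inj₁ e) =
  _ , merge₁₂ˡ (0<½n⇒2≤n a) (0<½n⇒2≤n b) , merged-balanced x y (evens⇒x+y≡z x y z px py pz e)
split⇒Reply x y z (px , py , pz) ((a , b , c) , inj₂ (inj₁ e)) =
  _ , merge₁₃ˡ (0<½n⇒2≤n a) (0<½n⇒2≤n c) ,
  swap₂₃ (x + z) 0 y (merged-balanced x z (evens⇒x+y≡z x z y px pz py e))
split⇒Reply x y z (px , py , pz) ((a , b , c) , inj₂ (inj₂ e)) =
  _ , merge₂₃ˡ (0<½n⇒2≤n b) (0<½n⇒2≤n c) ,
  rotateʳ (y + z) 0 x (merged-balanced y z (evens⇒x+y≡z y z x py pz px e))

unbalanced⇒Reply : ∀ p → ¬ Balanced p → Reply p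
unbalanced⇒Reply (x , y , z) ¬b with ⌊ x /2⌋ ⊻ ⌊ y /2⌋ ⊻ ⌊ z /2⌋ ≟ 0
unbalanced⇒Reply (x , y , z) ¬b | no ne
  with ½-Reducible x y z (nonzero⇒reducible ⌊ x /2⌋ ⌊ y /2⌋ ⌊ z /2⌋ ne)
... | inj₁ l        = remove-from₁ x y z (½<⇒Removal x y z l)
... | inj₂ (inj₁ l) = remove-from₂ x y z (½<⇒Removal y x z l)
... | inj₂ (inj₂ l) = remove-from₃ x y z (½<⇒Removal z x y l)
unbalanced⇒Reply (x , y , z) ¬b | yes bal with some-odd x y z
... | inj₁ (inj₁ odd-x) = remove-from₁ x y z (odd⇒Removal x y z bal odd-x ¬b)
... | inj₁ (inj₂ (inj₁ odd-y)) = remove-from₂ x y z (odd⇒Removal y x z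
      (trans (⊻-swap₁₂ ⌊ y /2⌋ ⌊ x /2⌋ ⌊ z /2⌋) bal) odd-y (¬b ∘ swap₁₂ y x z))
... | inj₁ (inj₂ (inj₂ odd-z)) = remove-from₃ x y z (odd⇒Removal z x y
      (trans (sym (⊻-rotate ⌊ x /2⌋ ⌊ y /2⌋ ⌊ z /2⌋)) bal) odd-z (¬b ∘ rotateˡ z x y))
... | inj₂ evens with split? ⌊ x /2⌋ ⌊ y /2⌋ ⌊ z /2⌋
...   | yes s = split⇒Reply x y z evens s
-- The nim-sum is even with half zero, so it is 0, the value of `σ` without a split: the position
-- would be balanced.
...   | no ¬s = contradiction
        (trans (½≡0∧even⇒≡0 _ (trans (½-⊻₃ x y z) bal) (even⇒⊻₃-even x y z evens))
               (sym (σ-¬split ¬s))) ¬b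

-- Counting each nonempty pile once more makes amalgamation decrease the total.
pile-weight : ℕ → ℕ
pile-weight zero    = 0
pile-weight (suc n) = 2 + n

weight : Position → ℕ
weight (x , y , z) = pile-weight x + pile-weight y + pile-weight z

pile-weight-mono-< : ∀ {m n} → m < n → pile-weight m < pile-weight n
pile-weight-mono-< {zero}  {suc n} _         = s≤s z≤n
pile-weight-mono-< {suc m} {suc n} (s≤s m<n) = s≤s (s≤s m<n)

pile-weight-merge : ∀ {m n} → 2 ≤ m → 2 ≤ n →
                    pile-weight (m + n) < pile-weight m + pile-weight n
pile-weight-merge {suc m} {suc n} _ _ = s≤s (s≤s (≤-reflexive (sym (+-suc m (suc n)))))

move-decreases : ∀ {p q} → p ⟶ q → weight q < weight p
move-decreases (remove₁ {x} {y} {z} l) =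
  +-monoˡ-< (pile-weight z) (+-monoˡ-< (pile-weight y) (pile-weight-mono-< l))
move-decreases (remove₂ {x} {y} {z} l) =
  +-monoˡ-< (pile-weight z) (+-monoʳ-< (pile-weight x) (pile-weight-mono-< l))
move-decreases (remove₃ {x} {y} l) =
  +-monoʳ-< (pile-weight x + pile-weight y) (pile-weight-mono-< l)
move-decreases (merge₁₂ˡ {x} {y} {z} a b)
  rewrite +-identityʳ (pile-weight (x + y)) =
  +-monoˡ-< (pile-weight z) (pile-weight-merge a b)
move-decreases (merge₁₂ʳ {x} {y} {z} a b) = +-monoˡ-< (pile-weight z) (pile-weight-merge a b)
move-decreases (merge₂₃ˡ {x} {y} {z} a b)
  rewrite +-identityʳ (pile-weight x + pile-weight (y + z))
        | +-assoc (pile-weight x) (pile-weight y) (pile-weight z) =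
  +-monoʳ-< (pile-weight x) (pile-weight-merge a b)
move-decreases (merge₂₃ʳ {x} {y} {z} a b)
  rewrite +-identityʳ (pile-weight x)
        | +-assoc (pile-weight x) (pile-weight y) (pile-weight z) =
  +-monoʳ-< (pile-weight x) (pile-weight-merge a b)
move-decreases (merge₁₃ˡ {x} {y} {z} a b)
  rewrite +-identityʳ (pile-weight (x + z) + pile-weight y)
        | +-assoc (pile-weight x) (pile-weight y) (pile-weight z)
        | +-comm (pile-weight y) (pile-weight z)
        | sym (+-assoc (pile-weight x) (pile-weight z) (pile-weight y)) =
  +-monoˡ-< (pile-weight y) (pile-weight-merge a b)
move-decreases (merge₁₃ʳ {x} {y} {z} a b)
  rewrite +-comm (pile-weight x) (pile-weight y)
        | +-assoc (pile-weight y) (pile-weight x) (pile-weight z) =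
  +-monoʳ-< (pile-weight y) (pile-weight-merge a b)

-- Winning strategies

-- Every move unbalances the position and some reply restores balance. The weight drops over each
-- such pair of moves, so play is finite.
Balanced⇒𝒫 : ∀ p → Balanced p → 𝒫-position p
Balanced⇒𝒫 p = go p (<-wellFounded (weight p))
  where
  go : ∀ p → Acc _<_ (weight p) → Balanced p → 𝒫-position p
  go p (acc rec) b = strategy λ {q} p⟶q →
    let r , q⟶r , br = unbalanced⇒Reply q (move-unbalances p⟶q b)
    in  r , q⟶r , go r (rec (<-trans (move-decreases q⟶r) (move-decreases p⟶q))) br

-- From an unbalanced position the opponent could move to a balanced one, and the strategy's answer
-- `r` would be unbalanced, against the induction on the strategy.
𝒫⇒Balanced : ∀ p → 𝒫-position p → Balanced p
𝒫⇒Balanced p (strategy reply) with balanced? p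
... | yes b = b
... | no ¬b with q , p⟶q , bq ← unbalanced⇒Reply p ¬b
            with r , q⟶r , 𝒫r ← reply p⟶q =
  contradiction (𝒫⇒Balanced r 𝒫r) (move-unbalances q⟶r bq)

-- The set P

⊻₃≡⊕₃ : ∀ x y z → x ⊻ y ⊻ z ≡ x ⊕ y ⊕ z
⊻₃≡⊕₃ x y z = trans (cong (_⊻ z) (⊻≡⊕ x y)) (⊻≡⊕ (x ⊕ y) z)

⊕₃≡0⇒⊻≡ : ∀ x y z → x ⊕ y ⊕ z ≡ 0 → x ⊻ y ≡ z
⊕₃≡0⇒⊻≡ x y z nim = ⊻≡0⇒≡ (trans (⊻₃≡⊕₃ x y z) nim)

⊻≡⇒⊕₃≡0 : ∀ x y z → x ⊻ y ≡ z → x ⊕ y ⊕ z ≡ 0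
⊻≡⇒⊕₃≡0 x y z nim = trans (sym (⊻₃≡⊕₃ x y z)) (trans (cong (_⊻ z) nim) (⊻-self z))

-- The triples of nim-sum zero, `z` being largest, whose halves split: see `N₀⇒Split` and
-- `½-split⇒N₀`. `Balanced` rejects exactly these among them.
N₀ : Pred Position 0ℓ
N₀ = N₀,₁ ∪ N₀,₂

x+y≡z+2∧y≤z⇒2≤x : ∀ {x y z} → x + y ≡ z + 2 → y ≤ z → 2 ≤ x
x+y≡z+2∧y≤z⇒2≤x {x} {y} {z} sum y≤z = +-cancelˡ-≤ z 2 x (begin
  z + 2   ≡⟨ sum ⟨
  x + y   ≤⟨ +-monoʳ-≤ x y≤z ⟩
  x + z   ≡⟨ +-comm x z ⟩
  z + x   ∎)
  where open ≤-Reasoning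

Split-intro₁ : ∀ {x y z} → x ⊻ y ≡ z → x + y ≡ z → 2 ≤ x → 2 ≤ y →
               Split ⌊ x /2⌋ ⌊ y /2⌋ ⌊ z /2⌋
Split-intro₁ nim sum 2≤x 2≤y = Split-intro 2≤x 2≤y (½-split nim (inj₁ sum))

Split-intro₂ : ∀ {x y z} → x ⊻ y ≡ z → x + y ≡ z + 2 → x ≤ z → y ≤ z →
               Split ⌊ x /2⌋ ⌊ y /2⌋ ⌊ z /2⌋
Split-intro₂ {x} {y} {z} nim sum x≤z y≤z = Split-intro
  (x+y≡z+2∧y≤z⇒2≤x sum y≤z) (x+y≡z+2∧y≤z⇒2≤x (trans (+-comm y x) sum) x≤z)
  (½-split nim (inj₂ (trans sum (+-comm z 2))))

N₀⇒Split : ∀ {x y z} → (x , y , z) ∈ N₀ → x ⊻ y ≡ z × Split ⌊ x /2⌋ ⌊ y /2⌋ ⌊ z /2⌋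
N₀⇒Split {x} {y} {z} (inj₁ (sum , _ , _ , nim₃ , 2≤x , 2≤y)) =
  nim , Split-intro₁ nim sum 2≤x 2≤y
  where
  nim : x ⊻ y ≡ z
  nim = ⊕₃≡0⇒⊻≡ x y z nim₃
N₀⇒Split {x} {y} {z} (inj₂ (sum , x≤z , y≤z , nim₃)) =
  nim , Split-intro₂ nim sum x≤z y≤z
  where
  nim : x ⊻ y ≡ z
  nim = ⊕₃≡0⇒⊻≡ x y z nim₃

-- `N₀,₁` and `N₀,₂` correspond to the absence and presence of a carry out of the last bits of `x`
-- and `y`.
½-split⇒N₀ : ∀ {x y z} → x ⊻ y ≡ z → 0 < ⌊ x /2⌋ → 0 < ⌊ y /2⌋ →
             ⌊ x /2⌋ + ⌊ y /2⌋ ≡ ⌊ z /2⌋ → (x , y , z) ∈ N₀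
½-split⇒N₀ {x} {y} {z} nim 0<½x 0<½y split =
  [ (λ sum → inj₁ (sum , x≤z , y≤z , nim₃ , 0<½n⇒2≤n 0<½x , 0<½n⇒2≤n 0<½y))
  , (λ sum → inj₂ (trans sum (+-comm 2 z) , x≤z , y≤z , nim₃)) ]′
    (½-split⇒sum-cases nim split)
  where
  x≤z : x ≤ z
  x≤z = <⇒≤ (½-cancel-< (subst (⌊ x /2⌋ <_) split (m<m+n _ 0<½y)))

  y≤z : y ≤ z
  y≤z = <⇒≤ (½-cancel-< (subst (⌊ y /2⌋ <_) split (m<n+m _ 0<½x)))

  nim₃ : x ⊕ y ⊕ z ≡ 0
  nim₃ = ⊻≡⇒⊕₃≡0 x y z nim

even⇒n⊻1+n≡1 : ∀ n → parity n ≡ 0ℙ → n ⊻ suc n ≡ 1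
even⇒n⊻1+n≡1 n even-n with odd-1+n , ½-1+n ← even-suc n even-n =
  ½-parity-injective (n ⊻ suc n) 1
    (trans (½-⊻ n (suc n)) (trans (cong (⌊ n /2⌋ ⊻_) ½-1+n) (⊻-self ⌊ n /2⌋)))
    (trans (parity-⊻ n (suc n)) (cong₂ ℙ._+_ even-n odd-1+n))

parity-sum : ∀ {x y z} → x ⊻ y ≡ z → parity (x + y) ≡ parity z
parity-sum {x} {y} nim = trans (parity-+≡parity-⊻ x y) (cong parity nim)

-- In both cases the shift flips only the last bit of the third entry, as its parity is that of
-- `x + y`. The halves stay and the nim-sum turns from 0 to 1.
Shift⇒Split : ∀ {N x y z} → (∀ {p} → p ∈ N → p ∈ N₀) → (x , y , z) ∈ Shift N →
              x ⊻ y ⊻ z ≡ 1 × Split ⌊ x /2⌋ ⌊ y /2⌋ ⌊ z /2⌋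
Shift⇒Split N⊆N₀ (even {x} {y} {z} 2∣x+y n) with nim , split ← N₀⇒Split (N⊆N₀ n) =
  trans (cong (_⊻ suc z) nim) (even⇒n⊻1+n≡1 z even-z) ,
  subst (Split _ _) (sym (proj₂ (even-suc z even-z))) split
  where
  even-z : parity z ≡ 0ℙ
  even-z = trans (sym (parity-sum nim)) (2∣⇒even 2∣x+y)
Shift⇒Split N⊆N₀ (odd {x} {y} {z} 2∤x+y n) with nim , split ← N₀⇒Split (N⊆N₀ n) =
  trans (cong (_⊻ z) nim) (trans (⊻-comm (suc z) z) (even⇒n⊻1+n≡1 z even-z)) ,
  subst (Split _ _) (proj₂ (even-suc z even-z)) split
  where
  even-z : parity z ≡ 0ℙ
  even-z = odd-suc z (trans (sym (parity-sum nim)) (2∤⇒odd (x + y) 2∤x+y))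

P₁,₁∪P₁,₂⇒Split : ∀ {x y z} → (x , y , z) ∈ P₁,₁ ∪ P₁,₂ →
                  x ⊻ y ⊻ z ≡ 1 × Split ⌊ x /2⌋ ⌊ y /2⌋ ⌊ z /2⌋
P₁,₁∪P₁,₂⇒Split = [ Shift⇒Split inj₁ , Shift⇒Split inj₂ ]′

-- Flipping the last bit of `z` gives a triple of `N₀`. The way back is an `odd` shift if `z` is
-- even and an `even` shift if `z` is odd.
½-split⇒P₁,₁∪P₁,₂ : ∀ x y z → x ⊻ y ⊻ z ≡ 1 → 0 < ⌊ x /2⌋ → 0 < ⌊ y /2⌋ →
                    ⌊ x /2⌋ + ⌊ y /2⌋ ≡ ⌊ z /2⌋ → (x , y , z) ∈ P₁,₁ ∪ P₁,₂
½-split⇒P₁,₁∪P₁,₂ x y z nim 0<½x 0<½y split with parity z in pz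
... | 0ℙ = [ inj₁ ∘ odd 2∤x+y , inj₂ ∘ odd 2∤x+y ]′
             (½-split⇒N₀ x⊻y≡1+z 0<½x 0<½y (trans split (sym (proj₂ (even-suc z pz)))))
  where
  x⊻y≡1+z : x ⊻ y ≡ suc z
  x⊻y≡1+z = trans (⊻-transpose nim)
    (trans (cong (z ⊻_) (sym (even⇒n⊻1+n≡1 z pz))) (⊻-cancel-middle z (suc z)))

  2∤x+y : ¬ 2 ∣ x + y
  2∤x+y 2∣x+y = contradiction
    (trans (sym (2∣⇒even 2∣x+y)) (trans (parity-sum x⊻y≡1+z) (proj₁ (even-suc z pz)))) λ ()
½-split⇒P₁,₁∪P₁,₂ x y (suc w) nim 0<½x 0<½y split | 1ℙ =
  [ inj₁ ∘ even 2∣x+y , inj₂ ∘ even 2∣x+y ]′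
    (½-split⇒N₀ x⊻y≡w 0<½x 0<½y (trans split (proj₂ (even-suc w even-w))))
  where
  even-w : parity w ≡ 0ℙ
  even-w = odd-suc w pz

  x⊻y≡w : x ⊻ y ≡ w
  x⊻y≡w = trans (⊻-transpose nim) (trans
    (cong (suc w ⊻_) (sym (trans (⊻-comm (suc w) w) (even⇒n⊻1+n≡1 w even-w))))
    (⊻-cancel-middle (suc w) w))

  2∣x+y : 2 ∣ x + y
  2∣x+y = even⇒2∣ (x + y) (trans (parity-sum x⊻y≡w) even-w)

P₀,₁∪P₀,₂⇒¬Split : ∀ {x y z} → (x , y , z) ∈ P₀,₁ ∪ P₀,₂ →
                   x ⊻ y ≡ z × ¬ Split ⌊ x /2⌋ ⌊ y /2⌋ ⌊ z /2⌋
P₀,₁∪P₀,₂⇒¬Split {x} {y} {z} (inj₁ (_ , _ , _ , nim₃ , x⊓y<2)) =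
  ⊕₃≡0⇒⊻≡ x y z nim₃ ,
  λ { ((a , b , _) , _) → <⇒≱ x⊓y<2 (⊓-glb (0<½n⇒2≤n a) (0<½n⇒2≤n b)) }
P₀,₁∪P₀,₂⇒¬Split {x} {y} {z} (inj₂ (large , x≤z , y≤z , nim₃)) = nim , ¬split
  where
  nim : x ⊻ y ≡ z
  nim = ⊕₃≡0⇒⊻≡ x y z nim₃

  -- Excludes the two splits in which `z`, a maximum, contributes a summand.
  too-large : ∀ {m n} → 0 < ⌊ m /2⌋ → ⌊ m /2⌋ + ⌊ z /2⌋ ≡ ⌊ n /2⌋ → ¬ n ≤ z
  too-large {m} {n} 0<½m eq n≤z =
    <⇒≱ (subst (⌊ z /2⌋ <_) eq (m<n+m _ 0<½m)) (⌊n/2⌋-mono n≤z)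

  ¬split : ¬ Split ⌊ x /2⌋ ⌊ y /2⌋ ⌊ z /2⌋
  ¬split (_ , inj₁ e) = <⇒≱ (subst (_< x + y) (+-comm z 2) large)
    ([ (λ sum → ≤-trans (≤-reflexive sum) (m≤n+m z 2)) , ≤-reflexive ]′
      (½-split⇒sum-cases nim e))
  ¬split ((a , _ , _) , inj₂ (inj₁ e)) = too-large a e y≤z
  ¬split ((_ , b , _) , inj₂ (inj₂ e)) = too-large b e x≤z

-- A sum of at most `z + 2` is `z` or `z + 2`. The latter forces a split, and so does the former
-- unless a pile is below 2.
¬Split⇒sum-cases : ∀ {x y z} → x ≤ z → y ≤ z → x ⊻ y ≡ z →
                   ¬ Split ⌊ x /2⌋ ⌊ y /2⌋ ⌊ z /2⌋ →
                   (x + y ≡ z × x ⊓ y < 2) ⊎ z + 2 < x + y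
¬Split⇒sum-cases {x} {y} {z} x≤z y≤z nim ¬s with z + 2 <? x + y
... | yes large = inj₂ large
... | no ¬large with sum-cases nim (subst (x + y ≤_) (+-comm z 2) (≮⇒≥ ¬large))
...   | inj₂ sum = contradiction (Split-intro₂ nim (trans sum (+-comm 2 z)) x≤z y≤z) ¬s
...   | inj₁ sum with x ⊓ y <? 2
...     | yes small = inj₁ (sum , small)
...     | no ¬small = contradiction
            (Split-intro₁ nim sum (m≤n⊓o⇒m≤n x y (≮⇒≥ ¬small)) (m≤n⊓o⇒m≤o x y (≮⇒≥ ¬small)))
            ¬s

¬Split⇒P₀,₁∪P₀,₂ : ∀ {x y z} → x ≤ z → y ≤ z → x ⊻ y ≡ z →
                   ¬ Split ⌊ x /2⌋ ⌊ y /2⌋ ⌊ z /2⌋ → (x , y , z) ∈ P₀,₁ ∪ P₀,₂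
¬Split⇒P₀,₁∪P₀,₂ {x} {y} {z} x≤z y≤z nim ¬s = Sum.map
  (λ { (sum , small) → sum , x≤z , y≤z , nim₃ , small })
  (λ large → large , x≤z , y≤z , nim₃)
  (¬Split⇒sum-cases x≤z y≤z nim ¬s)
  where
  nim₃ : x ⊕ y ⊕ z ≡ 0
  nim₃ = ⊻≡⇒⊕₃≡0 x y z nim

-- `P` before closing under arrangements of the piles.
Arranged : Pred Position 0ℓ
Arranged = (P₀,₁ ∪ P₀,₂) ∪ (P₁,₁ ∪ P₁,₂)

Arranged⇒Balanced : ∀ {p} → p ∈ Arranged → Balanced p
Arranged⇒Balanced {_ , _ , z} (inj₁ p) with nim , ¬s ← P₀,₁∪P₀,₂⇒¬Split p =
  trans (trans (cong (_⊻ z) nim) (⊻-self z)) (sym (σ-¬split ¬s))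
Arranged⇒Balanced {_} (inj₂ p) with nim , s ← P₁,₁∪P₁,₂⇒Split p =
  trans nim (sym (σ-split s))

Balanced-cases : ∀ x y z → x ≤ z → y ≤ z → Balanced (x , y , z) →
                 (x ⊻ y ≡ z × ¬ Split ⌊ x /2⌋ ⌊ y /2⌋ ⌊ z /2⌋) ⊎
                 (x ⊻ y ⊻ z ≡ 1 × 0 < ⌊ x /2⌋ × 0 < ⌊ y /2⌋ × ⌊ x /2⌋ + ⌊ y /2⌋ ≡ ⌊ z /2⌋)
Balanced-cases x y z x≤z y≤z b with split? ⌊ x /2⌋ ⌊ y /2⌋ ⌊ z /2⌋
... | no ¬s = inj₁ (⊻≡0⇒≡ (trans b (σ-¬split ¬s)) , ¬s)
... | yes s@((0<½x , 0<½y , _) , inj₁ e) =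
  inj₂ (trans b (σ-split s) , 0<½x , 0<½y , e)
... | yes ((0<½x , _) , inj₂ (inj₁ e)) =
  contradiction (⌊n/2⌋-mono y≤z) (<⇒≱ (subst (⌊ z /2⌋ <_) e (m<n+m _ 0<½x)))
... | yes ((_ , 0<½y , _) , inj₂ (inj₂ e)) =
  contradiction (⌊n/2⌋-mono x≤z) (<⇒≱ (subst (⌊ z /2⌋ <_) e (m<n+m _ 0<½y)))

Balanced⇒Arranged : ∀ x y z → x ≤ z → y ≤ z → Balanced (x , y , z) → (x , y , z) ∈ Arranged
Balanced⇒Arranged x y z x≤z y≤z b = Sum.map
  (λ { (nim , ¬s) → ¬Split⇒P₀,₁∪P₀,₂ x≤z y≤z nim ¬s })
  (λ { (nim , 0<½x , 0<½y , e) → ½-split⇒P₁,₁∪P₁,₂ x y z nim 0<½x 0<½y e })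
  (Balanced-cases x y z x≤z y≤z b)

P⇒Balanced : ∀ {x y z} → (x , y , z) ∈ P → Balanced (x , y , z)
P⇒Balanced             (inj₁ (inj₁ p))        = Arranged⇒Balanced (inj₁ p)
P⇒Balanced {x} {y} {z} (inj₁ (inj₂ (inj₁ p))) = swap₂₃ x z y (Arranged⇒Balanced (inj₁ p))
P⇒Balanced {x} {y} {z} (inj₁ (inj₂ (inj₂ p))) = rotateʳ y z x (Arranged⇒Balanced (inj₁ p))
P⇒Balanced             (inj₂ (inj₁ p))        = Arranged⇒Balanced (inj₂ p)
P⇒Balanced {x} {y} {z} (inj₂ (inj₂ (inj₁ p))) = swap₂₃ x z y (Arranged⇒Balanced (inj₂ p))
P⇒Balanced {x} {y} {z} (inj₂ (inj₂ (inj₂ p))) = rotateʳ y z x (Arranged⇒Balanced (inj₂ p))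

-- The alternatives match the arrangements in `SomeArrangement`, each of which puts the maximum
-- last.
some-maximum : ∀ x y z → (x ≤ z × y ≤ z) ⊎ (x ≤ y × z ≤ y) ⊎ (y ≤ x × z ≤ x)
some-maximum x y z with ≤-total x y | ≤-total y z | ≤-total x z
... | inj₁ x≤y | inj₁ y≤z | _        = inj₁ (≤-trans x≤y y≤z , y≤z)
... | inj₁ x≤y | inj₂ z≤y | _        = inj₂ (inj₁ (x≤y , z≤y))
... | inj₂ y≤x | _        | inj₁ x≤z = inj₁ (x≤z , ≤-trans y≤x x≤z)
... | inj₂ y≤x | _        | inj₂ z≤x = inj₂ (inj₂ (y≤x , z≤x))

Balanced⇒P : ∀ x y z → Balanced (x , y , z) → (x , y , z) ∈ P
Balanced⇒P x y z b = [ z-maximum , [ y-maximum , x-maximum ]′ ]′ (some-maximum x y z)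
  where
  z-maximum : x ≤ z × y ≤ z → (x , y , z) ∈ P
  z-maximum (x≤z , y≤z) = Sum.map inj₁ inj₁ (Balanced⇒Arranged x y z x≤z y≤z b)

  y-maximum : x ≤ y × z ≤ y → (x , y , z) ∈ P
  y-maximum (x≤y , z≤y) = Sum.map (inj₂ ∘ inj₁) (inj₂ ∘ inj₁)
    (Balanced⇒Arranged x z y x≤y z≤y (swap₂₃ x y z b))

  x-maximum : y ≤ x × z ≤ x → (x , y , z) ∈ P
  x-maximum (y≤x , z≤x) = Sum.map (inj₂ ∘ inj₂) (inj₂ ∘ inj₂)
    (Balanced⇒Arranged y z x y≤x z≤x (rotateˡ x y z b))

theorem2 : (x y z : ℕ) → 𝒫-position (x , y , z) ⇔ (x , y , z) ∈ P
theorem2 x y z = mk⇔ (Balanced⇒P x y z ∘ 𝒫⇒Balanced (x , y , z))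
                     (Balanced⇒𝒫 (x , y , z) ∘ P⇒Balanced)
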